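{- If $n$ is an odd perfect number and $p_1$ is its smallest prime factor, then $$H(n)\leq 2+\frac{9}{4p_1^2}.$$
   Context: A positive integer $n$ is perfect if $\sigma(n)=2n$, where $\sigma(n)$ is the sum of the positive divisors of $n$. $H(n)=\prod_{p\mid n}\frac{p}{p-1}$, where $p$ runs over the distinct prime divisors of $n$. -}

module Defs where

open import Data.Integer.Base using (+_)
open import Data.List.Base using (List; applyUpTo; filter; foldr; map)
open import Data.Nat.Base using (ℕ; 2+; suc; _*_; _^_; _≤_; _>_; NonZero)
open import Data.Nat.Divisibility using (_∣_; _∤_; _∣?_)
open import Data.Nat.ListAction using (sum)
open import Data.Nat.Primality using (Prime; prime?; prime⇒nonZero)
open import Data.Nat.Properties using (m*n≢0; m^n≢0)
open import Data.Product.Base using (_×_)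
open import Data.Rational.Base as ℚ using (ℚ; 1ℚ; _/_)
open import Relation.Binary.PropositionalEquality.Core using (_≡_)

Odd : ℕ → Set
Odd n = 2 ∤ n

divisors : ℕ → List ℕ
divisors n = filter (_∣? n) (applyUpTo suc n)

σ : ℕ → ℕ
σ n = sum (divisors n)

-- Positivity has to be required, since σ 0 ≡ 2 * 0.
Perfect : ℕ → Set
Perfect n = n > 0 × σ n ≡ 2 * n

primeDivisors : ℕ → List ℕ
primeDivisors n = filter prime? (divisors n)

-- p/(p-1); the value 1 for p < 2 is a dummy, as only primes are used below.
p/[p-1] : ℕ → ℚ
p/[p-1] p@(2+ k) = + p / suc k
p/[p-1] _        = 1ℚ

H : ℕ → ℚ
H n = foldr ℚ._*_ 1ℚ (map p/[p-1] (primeDivisors n))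

record IsSmallestPrimeFactor (p n : ℕ) : Set where
  field
    prime    : Prime p
    divides  : p ∣ n
    smallest : ∀ q → Prime q → q ∣ n → p ≤ q

4p²≢0 : ∀ {p n} → IsSmallestPrimeFactor p n → NonZero (4 * p ^ 2)
4p²≢0 {p} spf = m*n≢0 4 (p ^ 2) {{_}} {{m^n≢0 p 2 {{prime⇒nonZero prime}}}}
  where open IsSmallestPrimeFactor spf

{-# OPTIONS --safe #-}

-- If pᵃ exactly divides n, it contributes to H(n) n/σ(n) = H(n)/2 the factor 1/(1 − p⁻ᵃ⁻¹).
-- As σ(n) = 2n is not divisible by 4, at most one prime q has exponent 1; all the other factors are
-- at most 1/(1 − p⁻³), and since (1 + 5/(8(m+2)²))/(1 − m⁻³) ≤ 1 + 5/(8m²) for m ≥ 3, their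
-- product over odd primes p ≥ p₁ is at most 1 + 5/(8p₁²).  If q occurs, then (q + 1)/2 divides n,
-- so q ≥ 2p₁ − 1, and its factor q²/(q² − 1) still leaves a bound of 1 + 9/(8p₁²).

module Submission where

open import Defs
open import Data.Integer.Base as ℤ using (+_)
import Data.Integer.Properties as ℤ
open import Data.List.Base using (List; []; _∷_; _++_; applyUpTo; foldr; map)
open import Data.List.Membership.Propositional using (_∈_)
open import Data.List.Membership.Propositional.Properties
open import Data.List.Membership.Propositional.Properties.WithK using (unique∧set⇒bag)
open import Data.List.Relation.Binary.BagAndSetEquality using (∼bag⇒↭)
open import Data.List.Relation.Binary.Permutation.Propositional using (_↭_)
open import Data.List.Relation.Binary.Permutation.Propositional.Properties using (map⁺)
open import Data.List.Relation.Unary.All as All using (All; []; _∷_)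
open import Data.List.Relation.Unary.Any using (here; there)
open import Data.List.Relation.Unary.Unique.Propositional using (Unique; _∷_)
import Data.List.Relation.Unary.Unique.Propositional.Properties as Unique
open import Data.Nat.Base as ℕ
  using (ℕ; zero; suc; pred; _*_; _^_; z≤n; s≤s; NonZero; >-nonZero;
         NonTrivial; nonTrivial⇒nonZero; nonTrivial⇒≢1; nonTrivial⇒n>1; n>1⇒nonTrivial)
open import Data.Nat.Coprimality using (Coprime; coprime-divisor)
open import Data.Nat.Divisibility
open import Data.Nat.Induction using (<-rec)
open import Data.Nat.ListAction using (sum; product)
open import Data.Nat.ListAction.Properties using (sum-++; sum-↭; product-↭)
open import Data.Nat.Primality
open import Data.Nat.Primality.Factorisation using (factorise)
open import Data.Nat.Properties
open import Data.Nat.Tactic.RingSolver using (solve-∀)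
open import Data.Product.Base using (∃; ∃₂; _×_; _,_; proj₁; proj₂)
open import Data.Rational.Base as ℚ using (1ℚ; toℚᵘ; _/_; _+_; _≤_)
import Data.Rational.Properties as ℚ
open import Data.Rational.Unnormalised.Base as ℚᵘ using (mkℚᵘ; *≤*)
import Data.Rational.Unnormalised.Properties as ℚᵘ
open import Data.Sum.Base using (_⊎_; inj₁; inj₂; [_,_]′)
open import Function.Base using (id; _∘_)
open import Function.Bundles using (mk⇔)
open import Relation.Binary.PropositionalEquality
open import Relation.Nullary.Decidable using (yes; no; decidable-stable; ¬?; _×-dec_)
open import Relation.Nullary.Negation using (¬_; contradiction)

private
  variable
    d m n p q M : ℕ
    xs ys : List ℕ

-- Duplicate-free lists and divisibility by primes

unique∧set⇒↭ : Unique xs → Unique ys →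
  (∀ {x} → x ∈ xs → x ∈ ys) → (∀ {x} → x ∈ ys → x ∈ xs) → xs ↭ ys
unique∧set⇒↭ xs! ys! to from = ∼bag⇒↭ (unique∧set⇒bag xs! ys! (mk⇔ to from))

sum-map-* : ∀ c xs → sum (map (c *_) xs) ≡ c * sum xs
sum-map-* c []       = sym (*-zeroʳ c)
sum-map-* c (x ∷ xs) = trans (cong (c * x ℕ.+_) (sum-map-* c xs)) (sym (*-distribˡ-+ c x (sum xs)))

∤⇒coprime : Prime p → p ∤ n → Coprime p n
∤⇒coprime pp p∤n (d∣p , d∣n) =
  [ id , (λ d≡p → contradiction (subst (_∣ _) d≡p d∣n) p∤n) ]′
    (prime⇒irreducible pp d∣p)

prime-∣-prime : Prime p → Prime q → p ∣ q → p ≡ q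
prime-∣-prime pp pq p∣q =
  [ (λ p≡1 → contradiction (subst Prime p≡1 pp) ¬prime[1]) , id ]′
    (prime⇒irreducible pq p∣q)

prime-∣-^ : Prime p → Prime q → ∀ a → p ∣ q ^ a → p ≡ q
prime-∣-^ pp pq zero    p∣1 = contradiction (subst Prime (∣1⇒≡1 p∣1) pp) ¬prime[1]
prime-∣-^ pp pq (suc a) p∣q^1+a =
  [ prime-∣-prime pp pq , prime-∣-^ pp pq a ]′ (euclidsLemma _ _ pp p∣q^1+a)

-- A number `d` not divisible by the prime `p` is coprime to it, so the factors `p` can be removed
-- one at a time.
∤∧∣^*⇒∣ : Prime p → p ∤ d → ∀ a → d ∣ p ^ a * M → d ∣ M
∤∧∣^*⇒∣ {M = M} pp p∤d zero    d∣M = subst (_ ∣_) (*-identityˡ M) d∣M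
∤∧∣^*⇒∣ {p} {d} {M} pp p∤d (suc a) d∣N =
  ∤∧∣^*⇒∣ pp p∤d a
    (coprime-divisor (λ (e∣d , e∣p) → ∤⇒coprime pp p∤d (e∣p , e∣d))
      (subst (d ∣_) (*-assoc p (p ^ a) M) d∣N))

-- Divisors and prime divisors as duplicate-free lists

∈-divisors⁺ : .{{NonZero n}} → d ∣ n → d ∈ divisors n
∈-divisors⁺ {n} {zero}  0∣n = contradiction (0∣⇒≡0 0∣n) (ℕ.≢-nonZero⁻¹ n)
∈-divisors⁺ {n} {suc d} d∣n = ∈-filter⁺ (_∣? n) (∈-applyUpTo⁺ suc (∣⇒≤ d∣n)) d∣n

∈-divisors⁻ : ∀ n → d ∈ divisors n → d ∣ n
∈-divisors⁻ n d∈ = proj₂ (∈-filter⁻ (_∣? n) {xs = applyUpTo suc n} d∈)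

divisors-unique : ∀ n → Unique (divisors n)
divisors-unique n = Unique.filter⁺ (_∣? n) (Unique.applyUpTo⁺₁ suc n (λ i<j _ → <⇒≢ i<j ∘ suc-injective))

∈-primeDivisors⁺ : .{{NonZero n}} → Prime p → p ∣ n → p ∈ primeDivisors n
∈-primeDivisors⁺ pp p∣n = ∈-filter⁺ prime? (∈-divisors⁺ p∣n) pp

∈-primeDivisors⁻ : ∀ n → p ∈ primeDivisors n → Prime p × p ∣ n
∈-primeDivisors⁻ n p∈ =
  let p∈divs , pp = ∈-filter⁻ prime? {xs = divisors n} p∈ in pp , ∈-divisors⁻ n p∈divs

primeDivisors-unique : ∀ n → Unique (primeDivisors n)
primeDivisors-unique n = Unique.filter⁺ prime? (divisors-unique n)

-- Effect of a prime power factor on σ and on the prime divisors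

module _ (pp : Prime p) .{{_ : NonZero M}} (p∤M : p ∤ M) where

  private
    instance
      p≢0 : NonZero p
      p≢0 = prime⇒nonZero pp

    p^a*M≢0 : ∀ a → NonZero (p ^ a * M)
    p^a*M≢0 a = m*n≢0 (p ^ a) M {{m^n≢0 p a}}

  -- A divisor that is a multiple of `p` is `p` times a divisor of `p ^ a * M`; any other divisor
  -- already divides `M`. The two kinds are disjoint because `p ∤ M`.
  divisors-^* : ∀ a → divisors (p ^ suc a * M) ↭ map (p *_) (divisors (p ^ a * M)) ++ divisors M
  divisors-^* a = unique∧set⇒↭ (divisors-unique (p ^ suc a * M))
    (Unique.++⁺ (Unique.map⁺ (*-cancelˡ-≡ _ _ p) (divisors-unique (p ^ a * M))) (divisors-unique M) disjoint)
    to from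
    where
    instance
      _ = p^a*M≢0 a
      _ = p^a*M≢0 (suc a)

    disjoint : ∀ {d} → ¬ (d ∈ map (p *_) (divisors (p ^ a * M)) × d ∈ divisors M)
    disjoint (d∈p* , d∈) with ∈-map⁻ (p *_) d∈p*
    ... | e , _ , refl = p∤M (∣-trans (m∣m*n e) (∈-divisors⁻ M d∈))

    to : ∀ {d} → d ∈ divisors (p ^ suc a * M) → d ∈ map (p *_) (divisors (p ^ a * M)) ++ divisors M
    to {d} d∈ with p ∣? d
    ... | no p∤d = ∈-++⁺ʳ _ (∈-divisors⁺ (∤∧∣^*⇒∣ pp p∤d (suc a) (∈-divisors⁻ (p ^ suc a * M) d∈)))
    ... | yes (divides-refl e) = ∈-++⁺ˡ (subst (_∈ map (p *_) (divisors (p ^ a * M))) (*-comm p e)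
      (∈-map⁺ (p *_) (∈-divisors⁺ (*-cancelˡ-∣ p
        (subst₂ _∣_ (*-comm e p) (*-assoc p (p ^ a) M) (∈-divisors⁻ (p ^ suc a * M) d∈))))))

    from : ∀ {d} → d ∈ map (p *_) (divisors (p ^ a * M)) ++ divisors M → d ∈ divisors (p ^ suc a * M)
    from d∈ with ∈-++⁻ (map (p *_) (divisors (p ^ a * M))) d∈
    ... | inj₂ d∈M = ∈-divisors⁺ (∣n⇒∣m*n (p ^ suc a) (∈-divisors⁻ M d∈M))
    ... | inj₁ d∈p* with ∈-map⁻ (p *_) d∈p*
    ...   | e , e∈ , refl = ∈-divisors⁺
      (subst (p * e ∣_) (sym (*-assoc p (p ^ a) M)) (*-monoʳ-∣ p (∈-divisors⁻ (p ^ a * M) e∈)))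

  σ-^*-suc : ∀ a → σ (p ^ suc a * M) ≡ p * σ (p ^ a * M) ℕ.+ σ M
  σ-^*-suc a = begin
    σ (p ^ suc a * M)                                     ≡⟨ sum-↭ (divisors-^* a) ⟩
    sum (map (p *_) (divisors (p ^ a * M)) ++ divisors M) ≡⟨ sum-++ (map (p *_) (divisors (p ^ a * M))) (divisors M) ⟩
    sum (map (p *_) (divisors (p ^ a * M))) ℕ.+ σ M       ≡⟨ cong (ℕ._+ σ M) (sum-map-* p (divisors (p ^ a * M))) ⟩
    p * σ (p ^ a * M) ℕ.+ σ M                             ∎
    where open ≡-Reasoning

  -- σ(pᵃ) = (pᵃ⁺¹ − 1)/(p − 1), multiplied out.
  σ-^* : ∀ a → pred p * σ (p ^ a * M) ℕ.+ σ M ≡ p ^ suc a * σ M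
  σ-^* zero = begin
    pred p * σ (1 * M) ℕ.+ σ M ≡⟨ cong (λ m → pred p * σ m ℕ.+ σ M) (*-identityˡ M) ⟩
    pred p * σ M ℕ.+ σ M       ≡⟨ +-comm _ (σ M) ⟩
    suc (pred p) * σ M         ≡⟨ cong (_* σ M) (trans (suc-pred p) (sym (*-identityʳ p))) ⟩
    p * 1 * σ M                ∎
    where open ≡-Reasoning
  σ-^* (suc a) = begin
    r * σ (p ^ suc a * M) ℕ.+ σ M               ≡⟨ cong (λ s → r * s ℕ.+ σ M) (σ-^*-suc a) ⟩
    r * (p * σ (p ^ a * M) ℕ.+ σ M) ℕ.+ σ M     ≡⟨ lemma r p (σ (p ^ a * M)) (σ M) ⟩
    p * (r * σ (p ^ a * M)) ℕ.+ suc r * σ M     ≡⟨ cong (λ s → p * (r * σ (p ^ a * M)) ℕ.+ s * σ M) (suc-pred p) ⟩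
    p * (r * σ (p ^ a * M)) ℕ.+ p * σ M         ≡⟨ *-distribˡ-+ p _ (σ M) ⟨
    p * (r * σ (p ^ a * M) ℕ.+ σ M)             ≡⟨ cong (p *_) (σ-^* a) ⟩
    p * (p ^ suc a * σ M)                       ≡⟨ *-assoc p (p ^ suc a) (σ M) ⟨
    p ^ suc (suc a) * σ M                       ∎
    where
    open ≡-Reasoning
    r = pred p
    lemma : ∀ r p s t → r * (p * s ℕ.+ t) ℕ.+ t ≡ p * (r * s) ℕ.+ suc r * t
    lemma = solve-∀

  primeDivisors-^* : ∀ a → primeDivisors (p ^ suc a * M) ↭ p ∷ primeDivisors M
  primeDivisors-^* a = unique∧set⇒↭ (primeDivisors-unique (p ^ suc a * M))
    (All.tabulate (λ { q∈ refl → p∤M (proj₂ (∈-primeDivisors⁻ M q∈)) }) ∷ primeDivisors-unique M)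
    to from
    where
    instance
      _ = p^a*M≢0 (suc a)

    to : ∀ {q} → q ∈ primeDivisors (p ^ suc a * M) → q ∈ p ∷ primeDivisors M
    to q∈ = let pq , q∣N = ∈-primeDivisors⁻ (p ^ suc a * M) q∈ in
      [ here ∘ prime-∣-^ pq pp (suc a) , there ∘ ∈-primeDivisors⁺ pq ]′
        (euclidsLemma (p ^ suc a) M pq q∣N)

    from : ∀ {q} → q ∈ p ∷ primeDivisors M → q ∈ primeDivisors (p ^ suc a * M)
    from (here refl) = ∈-primeDivisors⁺ pp (∣m⇒∣m*n M (m∣m*n (p ^ a)))
    from (there q∈)  = let pq , q∣M = ∈-primeDivisors⁻ M q∈ in
      ∈-primeDivisors⁺ pq (∣n⇒∣m*n (p ^ suc a) q∣M)

-- H as an unreduced fraction of natural numbers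

-- Their quotient is H(n). Keeping the two products apart lets all estimates be cross-multiplied
-- inequalities in ℕ.
numerator denominator : ℕ → ℕ
numerator   n = product (primeDivisors n)
denominator n = product (map pred (primeDivisors n))

numerator-^* : Prime p → .{{NonZero M}} → p ∤ M → ∀ a → numerator (p ^ suc a * M) ≡ p * numerator M
numerator-^* pp p∤M a = product-↭ (primeDivisors-^* pp p∤M a)

denominator-^* : Prime p → .{{NonZero M}} → p ∤ M → ∀ a →
  denominator (p ^ suc a * M) ≡ pred p * denominator M
denominator-^* pp p∤M a = product-↭ (map⁺ pred (primeDivisors-^* pp p∤M a))

-- Splitting off prime powers, and parity

split-prime-power : ∀ p → .{{NonTrivial p}} → ∀ n → .{{NonZero n}} → ∃₂ λ a M → n ≡ p ^ a * M × p ∤ M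
split-prime-power p = <-rec _ go
  where
  Split : ℕ → Set
  Split n = .{{NonZero n}} → ∃₂ λ a M → n ≡ p ^ a * M × p ∤ M

  go : ∀ n → (∀ {m} → m ℕ.< n → Split m) → Split n
  go n rec with p ∣? n
  ... | no p∤n  = 0 , n , sym (*-identityˡ n) , p∤n
  ... | yes p∣n =
    let a , M , m≡ , p∤M = rec (quotient-< p∣n) {{quotient≢0 p∣n}} in
    suc a , M , trans (m∣n⇒n≡m*quotient p∣n) (trans (cong (p *_) m≡) (sym (*-assoc p (p ^ a) M))) , p∤M

prime-divisor : ∀ n → .{{NonTrivial n}} → ∃ λ p → Prime p × p ∣ n
prime-divisor n with factorise n {{nonTrivial⇒nonZero n}}
... | record { factors = []     ; isFactorisation = n≡1 } = contradiction n≡1 nonTrivial⇒≢1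
... | record { factors = p ∷ ps ; isFactorisation = n≡ ; factorsPrime = pp ∷ _ } =
  p , pp , subst (p ∣_) (sym n≡) (m∣m*n (product ps))

odd-suc : Odd n → 2 ∣ suc n
odd-suc {zero}        odd = contradiction (2 ∣0) odd
odd-suc {suc zero}    _   = ∣-refl
odd-suc {suc (suc n)} odd = ∣m∣n⇒∣m+n ∣-refl (odd-suc (odd ∘ ∣m∣n⇒∣m+n ∣-refl))

odd-∣ : Odd n → d ∣ n → Odd d
odd-∣ odd d∣n 2∣d = odd (∣-trans 2∣d d∣n)

odd-prime≥3 : Prime p → Odd p → 3 ℕ.≤ p
odd-prime≥3 pp odd =
  ≤∧≢⇒< (nonTrivial⇒n>1 _ {{prime⇒nonTrivial pp}}) (λ { refl → odd ∣-refl })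

-- Squarefull numbers and the bound on H(N) N / σ(N)

Squarefull : ℕ → Set
Squarefull n = ∀ {p} → Prime p → p ∣ n → p * p ∣ n

-- A prime `q` dividing `M` is not divisible by `p`, so neither is q², and q² ∣ pᵃM yields q² ∣ M.
squarefull-cofactor : Prime p → p ∤ M → ∀ a → Squarefull (p ^ a * M) → Squarefull M
squarefull-cofactor {p} {M} pp p∤M a sqf {q} pq q∣M =
  ∤∧∣^*⇒∣ pp p∤q² a (sqf pq (∣n⇒∣m*n (p ^ a) q∣M))
  where
  p∤q : p ∤ q
  p∤q p∣q = p∤M (∣-trans p∣q q∣M)

  p∤q² : p ∤ q * q
  p∤q² = [ p∤q , p∤q ]′ ∘ euclidsLemma q q pp

squarefull-exponent : Prime p → p ∤ M → ∀ a → p ∣ p ^ a * M → Squarefull (p ^ a * M) →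
  ∃ λ b → a ≡ suc (suc b)
squarefull-exponent {M = M} pp p∤M zero p∣N _ =
  contradiction (subst (_ ∣_) (*-identityˡ M) p∣N) p∤M
-- With exponent 1, cancelling `p` from p² ∣ pM would give p ∣ M.
squarefull-exponent {p} {M} pp p∤M (suc zero) p∣N sqf =
  contradiction (*-cancelˡ-∣ p {{prime⇒nonZero pp}}
    (subst (p * p ∣_) (cong (_* M) (*-identityʳ p)) (sqf pp p∣N))) p∤M
squarefull-exponent pp p∤M (suc (suc b)) _ _ = b , refl

-- H(N) N / σ(N) ≤ 1 + 5/(8m²), cross-multiplied.
Bound : ℕ → ℕ → Set
Bound m N = numerator N * N * (8 * (m * m)) ℕ.≤ σ N * denominator N * (8 * (m * m) ℕ.+ 5)

-- 1 + 5/(8m²) decreases as m grows; multiplying both sides by n² allows the comparison without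
-- division.
bound-weaken : ∀ {N} → .{{NonZero n}} → m ℕ.≤ n → Bound n N → Bound m N
bound-weaken {n} {m} {N} m≤n bound = *-cancelʳ-≤ _ _ (n * n) {{m*n≢0 n n}} (begin
  X * (8 * (m * m)) * (n * n)             ≡⟨ swap-squares X m n ⟩
  X * (8 * (n * n)) * (m * m)             ≤⟨ *-monoˡ-≤ (m * m) bound ⟩
  Y * (8 * (n * n) ℕ.+ 5) * (m * m)       ≡⟨ expand Y m n ⟩
  Y * (8 * (m * m) * (n * n) ℕ.+ 5 * (m * m)) ≤⟨ *-monoʳ-≤ Y (+-monoʳ-≤ (8 * (m * m) * (n * n)) (*-monoʳ-≤ 5 (*-mono-≤ m≤n m≤n))) ⟩
  Y * (8 * (m * m) * (n * n) ℕ.+ 5 * (n * n)) ≡⟨ collect Y m n ⟩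
  Y * (8 * (m * m) ℕ.+ 5) * (n * n)       ∎)
  where
  open ≤-Reasoning
  X = numerator N * N
  Y = σ N * denominator N
  swap-squares : ∀ x m n → x * (8 * (m * m)) * (n * n) ≡ x * (8 * (n * n)) * (m * m)
  swap-squares = solve-∀
  expand : ∀ y m n → y * (8 * (n * n) ℕ.+ 5) * (m * m) ≡ y * (8 * (m * m) * (n * n) ℕ.+ 5 * (m * m))
  expand = solve-∀
  collect : ∀ y m n → y * (8 * (m * m) * (n * n) ℕ.+ 5 * (n * n)) ≡ y * (8 * (m * m) ℕ.+ 5) * (n * n)
  collect = solve-∀

bound-1 : ∀ m → Bound m 1
bound-1 m = *-monoʳ-≤ 1 (m≤m+n (8 * (m * m)) 5)

-- K/(K−1) · (1 + 5/(8(m+2)²)) ≤ 1 + 5/(8m²) for K ≥ m³ and m ≥ 3.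
telescope : 3 ℕ.≤ m → ∀ {K} → m * m * m ℕ.≤ K →
  K * (m * m) * (8 * ((2 ℕ.+ m) * (2 ℕ.+ m)) ℕ.+ 5) ℕ.+ (8 * (m * m) ℕ.+ 5) * ((2 ℕ.+ m) * (2 ℕ.+ m))
    ℕ.≤ K * ((8 * (m * m) ℕ.+ 5) * ((2 ℕ.+ m) * (2 ℕ.+ m)))
telescope {m} 3≤m {K} m³≤K = begin
  K * (m * m) * (8 * m′² ℕ.+ 5) ℕ.+ (8 * (m * m) ℕ.+ 5) * m′² ≤⟨ +-monoʳ-≤ (K * (m * m) * (8 * m′² ℕ.+ 5)) excess ⟩
  K * (m * m) * (8 * m′² ℕ.+ 5) ℕ.+ K * (20 * (m ℕ.+ 1))      ≡⟨ factor m K ⟩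
  K * ((8 * (m * m) ℕ.+ 5) * m′²)                             ∎
  where
  open ≤-Reasoning
  m′² = (2 ℕ.+ m) * (2 ℕ.+ m)

  -- The gap between (8m² + 5)(m + 2)² and m²(8(m + 2)² + 5) is 5(m + 2)² - 5m² = 20(m + 1).
  factor : ∀ m K →
    K * (m * m) * (8 * ((2 ℕ.+ m) * (2 ℕ.+ m)) ℕ.+ 5) ℕ.+ K * (20 * (m ℕ.+ 1)) ≡
    K * ((8 * (m * m) ℕ.+ 5) * ((2 ℕ.+ m) * (2 ℕ.+ m)))
  factor = solve-∀

  -- After the substitution m = 3 + k, the difference of the two sides of the needed inequality has
  -- only positive coefficients.
  quartic : ∀ k → let m = 3 ℕ.+ k in
    (8 * (m * m) ℕ.+ 5) * ((2 ℕ.+ m) * (2 ℕ.+ m))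
      ℕ.+ (12 * (k * k * k * k) ℕ.+ 132 * (k * k * k) ℕ.+ 503 * (k * k) ℕ.+ 730 * k ℕ.+ 235)
    ≡ m * m * m * (20 * (m ℕ.+ 1))
  quartic = solve-∀

  excess : (8 * (m * m) ℕ.+ 5) * m′² ℕ.≤ K * (20 * (m ℕ.+ 1))
  excess with m≤n⇒∃[o]m+o≡n 3≤m
  ... | k , refl = ≤-trans (≤-trans (m≤m+n _ _) (≤-reflexive (quartic k))) (*-monoˡ-≤ _ m³≤K)

-- Passing from `M` to N = pᵇ⁺²M multiplies H(N) N / σ(N) by K/(K - 1) with K = pᵇ⁺³ ≥ p³. By
-- `telescope`, this factor is paid for by lowering 2 + p to p in the bound.
bound-^* : Prime p → .{{NonZero M}} → p ∤ M → 3 ℕ.≤ p → ∀ b →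
  Bound (2 ℕ.+ p) M → Bound p (p ^ suc (suc b) * M)
-- The factor `p′²` clears the denominator of the bound for `M`. The summand added to both sides
-- turns (p - 1)σ(N) = (K - 1)σ(M) into a statement free of subtraction.
bound-^* {p} {M} pp p∤M 3≤p b bound = *-cancelʳ-≤ _ _ p′² (+-cancelʳ-≤ (S * D * (f * p′²)) _ _ (begin
  numerator N * N * (8 * p²) * p′² ℕ.+ S * D * (f * p′²)
    ≡⟨ cong (λ x → x * N * (8 * p²) * p′² ℕ.+ S * D * (f * p′²)) (numerator-^* pp p∤M (suc b)) ⟩
  p * P * (p ^ suc (suc b) * M) * (8 * p²) * p′² ℕ.+ S * D * (f * p′²)
    ≡⟨ cong (ℕ._+ S * D * (f * p′²)) (regroup p P (p ^ suc (suc b)) M p² p′²) ⟩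
  K * p² * (P * M * (8 * p′²)) ℕ.+ S * D * (f * p′²)
    ≤⟨ +-monoˡ-≤ _ (*-monoʳ-≤ (K * p²) bound) ⟩
  K * p² * (S * D * (8 * p′² ℕ.+ 5)) ℕ.+ S * D * (f * p′²)
    ≡⟨ factor (K * p²) (S * D) (8 * p′² ℕ.+ 5) (f * p′²) ⟩
  S * D * (K * p² * (8 * p′² ℕ.+ 5) ℕ.+ f * p′²)
    ≤⟨ *-monoʳ-≤ (S * D) (telescope 3≤p p³≤K) ⟩
  S * D * (K * (f * p′²))
    ≡⟨ regroup′ S D K (f * p′²) ⟩
  K * S * (D * (f * p′²))
    ≡⟨ cong (_* (D * (f * p′²))) (σ-^* pp p∤M (suc (suc b))) ⟨
  (r * σ N ℕ.+ S) * (D * (f * p′²))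
    ≡⟨ expand r (σ N) S D f p′² ⟩
  σ N * (r * D) * f * p′² ℕ.+ S * D * (f * p′²)
    ≡⟨ cong (λ d → σ N * d * f * p′² ℕ.+ S * D * (f * p′²)) (denominator-^* pp p∤M (suc b)) ⟨
  σ N * denominator N * f * p′² ℕ.+ S * D * (f * p′²) ∎))
  where
  open ≤-Reasoning
  N = p ^ suc (suc b) * M
  K = p ^ suc (suc (suc b))
  r = pred p
  P = numerator M
  D = denominator M
  S = σ M
  p² = p * p
  p′² = (2 ℕ.+ p) * (2 ℕ.+ p)
  f = 8 * p² ℕ.+ 5

  p³≤K : p * p * p ℕ.≤ K
  p³≤K = ≤-trans (≤-reflexive (trans (*-assoc p p p) (cong (λ x → p * (p * x)) (sym (*-identityʳ p)))))
    (^-monoʳ-≤ p {{prime⇒nonZero pp}} {3} {3 ℕ.+ b} (s≤s (s≤s (s≤s z≤n))))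

  regroup : ∀ p P L M s t → p * P * (L * M) * (8 * s) * t ≡ p * L * s * (P * M * (8 * t))
  regroup = solve-∀
  factor : ∀ x y u v → x * (y * u) ℕ.+ y * v ≡ y * (x * u ℕ.+ v)
  factor = solve-∀
  regroup′ : ∀ S D K v → S * D * (K * v) ≡ K * S * (D * v)
  regroup′ = solve-∀
  expand : ∀ r s S D f t → (r * s ℕ.+ S) * (D * (f * t)) ≡ s * (r * D) * f * t ℕ.+ S * D * (f * t)
  expand = solve-∀

-- Trial division: k bounds the number of candidate divisors from m on.
squarefull-bound : ∀ k m N → .{{NonZero N}} → N ℕ.< m ℕ.+ k → 3 ℕ.≤ m → m Rough N →
  Odd N → Squarefull N → Bound m N
squarefull-bound k m 1 _ _ _ _ _ = bound-1 m
-- No candidates are left: an `m`-rough N ≥ 2 satisfies m ≤ N, against N < m.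
squarefull-bound zero m N@(ℕ.2+ _) N<m+0 _ rough _ _ =
  contradiction (subst (N ℕ.<_) (+-identityʳ m) N<m+0) (≤⇒≯ (rough⇒≤ rough))
squarefull-bound (suc k) m N@(ℕ.2+ _) N<m+1+k 3≤m rough odd sqf with m ∣? N
... | no m∤N = bound-weaken {n = suc m} {N = N} (n≤1+n m)
  (squarefull-bound k (suc m) N (subst (N ℕ.<_) (+-suc m k) N<m+1+k) (m≤n⇒m≤1+n 3≤m)
    (∤⇒rough-suc m∤N rough) odd sqf)
... | yes m∣N = peel (split-prime-power m N)
  where
  instance
    m-nonTrivial : NonTrivial m
    m-nonTrivial = n>1⇒nonTrivial (≤-trans (n≤1+n 2) 3≤m)

  -- A smaller nontrivial divisor of `m` would also divide `N`, against roughness.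
  pm : Prime m
  pm = rough∧∣⇒prime rough m∣N

  peel : ∃₂ (λ a M → N ≡ m ^ a * M × m ∤ M) → Bound m N
  peel (a , M , N≡ , m∤M) with squarefull-exponent pm m∤M a (subst (m ∣_) N≡ m∣N) (subst Squarefull N≡ sqf)
  ... | b , refl = subst (Bound m) (sym N≡) (bound-^* pm m∤M 3≤m b
    (squarefull-bound k (2 ℕ.+ m) M M<2+m+k (m≤n⇒m≤o+n 2 3≤m) rough′ oddM
      (squarefull-cofactor pm m∤M (suc (suc b)) (subst Squarefull N≡ sqf))))
    where
    M∣N : M ∣ N
    M∣N = subst (M ∣_) (sym N≡) (n∣m*n (m ^ suc (suc b)))

    instance
      M≢0 : NonZero M
      M≢0 = ℕ.≢-nonZero (λ { refl → contradiction (0∣⇒≡0 M∣N) λ () })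

    M<2+m+k : M ℕ.< 2 ℕ.+ m ℕ.+ k
    M<2+m+k = ≤-trans (s≤s (∣⇒≤ M∣N)) (≤-trans (subst (N ℕ.<_) (+-suc m k) N<m+1+k) (n≤1+n _))

    oddM : Odd M
    oddM = odd-∣ odd M∣N

    -- Since `m` is odd, m + 1 is even and cannot divide the odd `M`. Roughness therefore advances
    -- by 2, which is the gap that `bound-^*` requires.
    rough′ : (2 ℕ.+ m) Rough M
    rough′ = ∤⇒rough-suc (oddM ∘ ∣-trans (odd-suc (odd-∣ odd m∣N)))
      (∤⇒rough-suc m∤M (rough∧∣⇒rough rough M∣N))

-- Primes of exponent one

σ-* : Prime q → .{{NonZero M}} → q ∤ M → σ (q * M) ≡ suc q * σ M
σ-* {q} {M} pq q∤M = begin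
  σ (q * M)             ≡⟨ cong (λ x → σ (x * M)) (*-identityʳ q) ⟨
  σ (q ^ 1 * M)         ≡⟨ σ-^*-suc pq q∤M 0 ⟩
  q * σ (1 * M) ℕ.+ σ M ≡⟨ cong (λ m → q * σ m ℕ.+ σ M) (*-identityˡ M) ⟩
  q * σ M ℕ.+ σ M       ≡⟨ +-comm (q * σ M) (σ M) ⟩
  suc q * σ M           ∎
  where open ≡-Reasoning

-- A prime violating squarefullness divides `n` exactly once and is at most `n`, so a bounded search
-- finds it or shows that there is none.
squarefull? : ∀ n → .{{NonZero n}} → Squarefull n ⊎ ∃₂ λ q M → Prime q × n ≡ q * M × q ∤ M
squarefull? n with anyUpTo? (λ q → prime? q ×-dec q ∣? n ×-dec ¬? (q * q ∣? n)) (suc n)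
... | yes (q , _ , pq , divides M n≡M*q , q²∤n) =
  inj₂ (q , M , pq , n≡q*M , λ q∣M → q²∤n (subst (q * q ∣_) (sym n≡q*M) (*-monoʳ-∣ q q∣M)))
  where n≡q*M = trans n≡M*q (*-comm M q)
... | no ¬∃ = inj₁ λ {p} pp p∣n →
  decidable-stable (p * p ∣? n) λ p²∤n → ¬∃ (p , s≤s (∣⇒≤ p∣n) , pp , p∣n , p²∤n)

-- With two primes to the first power, 4 divides σ(n) = 2n.
squarefull-perfect-cofactor : Odd (q * M) → .{{NonZero M}} → Prime q → q ∤ M →
  σ (q * M) ≡ 2 * (q * M) → Squarefull M
squarefull-perfect-cofactor {q} {M} odd pq q∤M perfect with squarefull? M
... | inj₁ sqf = sqf
... | inj₂ (r , L , pr , refl , r∤L) = contradiction 2∣n odd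
  where
  instance
    L≢0 : NonZero L
    L≢0 = m*n≢0⇒n≢0 r

  2∣n : 2 ∣ q * (r * L)
  -- Both q + 1 and r + 1 are even, and (q + 1)(r + 1)σ(L) = 2n; cancelling 2 from 4 ∣ 2n makes `n`
  -- even.
  2∣n = *-cancelˡ-∣ 2 (subst (2 * 2 ∣_)
    (trans (cong (suc q *_) (sym (σ-* pr r∤L))) (trans (sym (σ-* pq q∤M)) perfect))
    (*-pres-∣ (odd-suc {q} (odd-∣ odd (m∣m*n (r * L))))
      (∣m⇒∣m*n (σ L) (odd-suc {r} (odd-∣ odd (∣n⇒∣m*n q (m∣m*n L)))))))

-- Estimates in terms of the smallest prime factor

module _ {n p : ℕ} (odd : Odd n) (spf : IsSmallestPrimeFactor p n) where
  open IsSmallestPrimeFactor spf renaming (prime to pp; divides to p∣n)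

  -- A nontrivial divisor below `p` would have a prime factor below `p`, and that factor divides
  -- `n`.
  smallest-rough : p Rough n
  smallest-rough (hasNonTrivialDivisor {divisor = d} d<p d∣n) =
    let q , pq , q∣d = prime-divisor d in
    <⇒≱ d<p (≤-trans (smallest q pq (∣-trans q∣d d∣n)) (∣⇒≤ {{nonTrivial⇒nonZero d}} q∣d))

  3≤smallest : 3 ℕ.≤ p
  3≤smallest = odd-prime≥3 pp (odd-∣ odd p∣n)

  smallest-bound : .{{NonZero M}} → M ∣ n → Squarefull M → Bound p M
  smallest-bound {M} M∣n sqf = squarefull-bound (suc M) p M (m≤n+m (suc M) p) 3≤smallest
    (rough∧∣⇒rough smallest-rough M∣n) (odd-∣ odd M∣n) sqf

  -- (q + 1)/2 divides n.
  exceptional-prime-large : Prime q → .{{NonZero M}} → q ∤ M → n ≡ q * M → σ n ≡ 2 * n → 2 * p ℕ.≤ suc q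
  exceptional-prime-large {q} {M} pq q∤M refl perfect with odd-suc (odd-∣ odd (m∣m*n M))
  ... | divides s 1+q≡s*2 =
    let t , pt , t∣s = prime-divisor s in begin
    2 * p ≤⟨ *-monoʳ-≤ 2 (≤-trans (smallest t pt (∣-trans t∣s s∣n)) (∣⇒≤ {{nonTrivial⇒nonZero s}} t∣s)) ⟩
    2 * s ≡⟨ 1+q≡2*s ⟨
    suc q ∎
    where
    open ≤-Reasoning
    1+q≡2*s : suc q ≡ 2 * s
    1+q≡2*s = trans 1+q≡s*2 (*-comm s 2)

    -- Here 2n = σ(n) = (q + 1)σ(M) = 2s σ(M), so n = s σ(M).
    s∣n : s ∣ q * M
    s∣n = *-cancelˡ-∣ 2 (divides (σ M) (trans (sym perfect)
      (trans (σ-* pq q∤M) (trans (*-comm (suc q) (σ M)) (cong (σ M *_) 1+q≡2*s)))))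

    -- From 2 < q + 1 = 2s follows s > 1, so `s` has a prime factor to compare with `p`.
    instance
      s-nonTrivial : NonTrivial s
      s-nonTrivial = n>1⇒nonTrivial (*-cancelˡ-< 2 1 s
        (subst (2 ℕ.<_) 1+q≡2*s (s≤s (nonTrivial⇒n>1 q {{prime⇒nonTrivial pq}}))))

-- q²/(q² − 1) · (1 + 5/(8p²)) ≤ 1 + 9/(8p²) for q = r + 1 ≥ 2p − 1 and p ≥ 3.
exceptional-factor : ∀ {p r} → 3 ℕ.≤ p → 2 * p ℕ.≤ 2 ℕ.+ r →
  suc r * suc r * (8 * (p * p) ℕ.+ 5) ℕ.≤ r * (2 ℕ.+ r) * (8 * (p * p) ℕ.+ 9)
exceptional-factor {p} {r} 3≤p 2p≤2+r = begin
  suc r * suc r * (8 * (p * p) ℕ.+ 5)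
    ≡⟨ expand r p ⟩
  r * (2 ℕ.+ r) * (8 * (p * p) ℕ.+ 5) ℕ.+ (8 * (p * p) ℕ.+ 5)
    ≤⟨ +-monoʳ-≤ (r * (2 ℕ.+ r) * (8 * (p * p) ℕ.+ 5)) excess ⟩
  r * (2 ℕ.+ r) * (8 * (p * p) ℕ.+ 5) ℕ.+ r * (2 ℕ.+ r) * 4
    ≡⟨ collect (r * (2 ℕ.+ r)) (p * p) ⟩
  r * (2 ℕ.+ r) * (8 * (p * p) ℕ.+ 9) ∎
  where
  open ≤-Reasoning
  -- With q = r + 1, q² = r(r + 2) + 1, so it remains to show 8p² + 5 ≤ 4r(r + 2).
  expand : ∀ r p → suc r * suc r * (8 * (p * p) ℕ.+ 5)
    ≡ r * (2 ℕ.+ r) * (8 * (p * p) ℕ.+ 5) ℕ.+ (8 * (p * p) ℕ.+ 5)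
  expand = solve-∀
  collect : ∀ x y → x * (8 * y ℕ.+ 5) ℕ.+ x * 4 ≡ x * (8 * y ℕ.+ 9)
  collect = solve-∀

  -- Put p = 3 + k and r = 2p - 2 + j = 4 + 2k + j; the difference then has only positive
  -- coefficients.
  quadratic : ∀ k j → let p = 3 ℕ.+ k; r = 4 ℕ.+ 2 * k ℕ.+ j in
    8 * (p * p) ℕ.+ 5 ℕ.+ (19 ℕ.+ 32 * k ℕ.+ 8 * (k * k) ℕ.+ 40 * j ℕ.+ 16 * (k * j) ℕ.+ 4 * (j * j))
    ≡ r * (2 ℕ.+ r) * 4
  quadratic = solve-∀

  2p≡ : ∀ k → 2 * (3 ℕ.+ k) ≡ 2 ℕ.+ (4 ℕ.+ 2 * k)
  2p≡ = solve-∀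

  excess : 8 * (p * p) ℕ.+ 5 ℕ.≤ r * (2 ℕ.+ r) * 4
  excess with m≤n⇒∃[o]m+o≡n 3≤p
  ... | k , refl with m≤n⇒∃[o]m+o≡n (+-cancelˡ-≤ 2 _ r (subst (ℕ._≤ 2 ℕ.+ r) (2p≡ k) 2p≤2+r))
  ...   | j , refl = ≤-trans (m≤m+n _ _) (≤-reflexive (quadratic k j))

-- The two cases of the cross-multiplied bound

-- As σ(n) = 2n, the hypothesis says H(n)/2 ≤ 1 + 5/(8p²). Doubling and relaxing 5 to 9 gives H(n) ≤
-- 2 + 9/(4p²).
squarefull-case : .{{NonZero n}} → σ n ≡ 2 * n → Bound p n →
  numerator n * (4 * (p * p)) ℕ.≤ (8 * (p * p) ℕ.+ 9) * denominator n
squarefull-case {n} {p} perfect bound = *-cancelʳ-≤ _ _ (2 * n) {{m*n≢0 2 n}} (begin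
  P * (4 * (p * p)) * (2 * n)             ≡⟨ regroup P (p * p) n ⟩
  P * n * (8 * (p * p))                   ≤⟨ bound ⟩
  σ n * D * (8 * (p * p) ℕ.+ 5)           ≡⟨ cong (λ s → s * D * (8 * (p * p) ℕ.+ 5)) perfect ⟩
  2 * n * D * (8 * (p * p) ℕ.+ 5)         ≤⟨ *-monoʳ-≤ (2 * n * D) (+-monoʳ-≤ (8 * (p * p)) (m≤m+n 5 4)) ⟩
  2 * n * D * (8 * (p * p) ℕ.+ 9)         ≡⟨ regroup′ (2 * n) D (8 * (p * p) ℕ.+ 9) ⟩
  (8 * (p * p) ℕ.+ 9) * D * (2 * n)       ∎)
  where
  open ≤-Reasoning
  P = numerator n
  D = denominator n
  regroup : ∀ P s n → P * (4 * s) * (2 * n) ≡ P * n * (8 * s)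
  regroup = solve-∀
  regroup′ : ∀ m D f → m * D * f ≡ f * D * m
  regroup′ = solve-∀

-- The prime `q` contributes q/(q - 1) to H, q to n and q + 1 to σ(n), hence q²/(q² - 1) to H(n) n /
-- σ(n); `exceptional-factor` combines this with the bound for `M`.
exceptional-case : Prime q → .{{NonZero M}} → q ∤ M → 3 ℕ.≤ p → 2 * p ℕ.≤ suc q →
  σ (q * M) ≡ 2 * (q * M) → Bound p M →
  numerator (q * M) * (4 * (p * p)) ℕ.≤ (8 * (p * p) ℕ.+ 9) * denominator (q * M)
exceptional-case {zero} pq = contradiction pq ¬prime[0]
exceptional-case {q@(suc r)} {M} {p} pq q∤M 3≤p 2p≤1+q perfect bound =
  *-cancelʳ-≤ _ _ (2 * (q * M)) {{m*n≢0 2 (q * M) {{_}} {{m*n≢0 q M}}}} (begin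
  numerator (q * M) * (4 * p²) * (2 * (q * M)) ≡⟨ cong (λ x → x * (4 * p²) * (2 * (q * M))) numerator-q*M ⟩
  q * P * (4 * p²) * (2 * (q * M))             ≡⟨ regroup q P p² M ⟩
  q * q * (P * M * (8 * p²))                   ≤⟨ *-monoʳ-≤ (q * q) bound ⟩
  q * q * (S * D * (8 * p² ℕ.+ 5))             ≡⟨ regroup′ (q * q) (S * D) (8 * p² ℕ.+ 5) ⟩
  S * D * (q * q * (8 * p² ℕ.+ 5))             ≤⟨ *-monoʳ-≤ (S * D) (exceptional-factor 3≤p 2p≤1+q) ⟩
  S * D * (r * suc q * (8 * p² ℕ.+ 9))         ≡⟨ regroup″ S D r (suc q) (8 * p² ℕ.+ 9) ⟩
  (8 * p² ℕ.+ 9) * (r * D) * (suc q * S)       ≡⟨ cong ((8 * p² ℕ.+ 9) * (r * D) *_) (trans (sym (σ-* pq q∤M)) perfect) ⟩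
  (8 * p² ℕ.+ 9) * (r * D) * (2 * (q * M))     ≡⟨ cong (λ x → (8 * p² ℕ.+ 9) * x * (2 * (q * M))) denominator-q*M ⟨
  (8 * p² ℕ.+ 9) * denominator (q * M) * (2 * (q * M)) ∎)
  where
  open ≤-Reasoning
  P = numerator M
  D = denominator M
  S = σ M
  p² = p * p

  q^1*M≡q*M : q ^ 1 * M ≡ q * M
  q^1*M≡q*M = cong (_* M) (*-identityʳ q)

  numerator-q*M : numerator (q * M) ≡ q * P
  numerator-q*M = trans (cong numerator (sym q^1*M≡q*M)) (numerator-^* pq q∤M 0)

  denominator-q*M : denominator (q * M) ≡ r * D
  denominator-q*M = trans (cong denominator (sym q^1*M≡q*M)) (denominator-^* pq q∤M 0)

  regroup : ∀ q P s M → q * P * (4 * s) * (2 * (q * M)) ≡ q * q * (P * M * (8 * s))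
  regroup = solve-∀
  regroup′ : ∀ x y f → x * (y * f) ≡ y * (x * f)
  regroup′ = solve-∀
  regroup″ : ∀ S D r t f → S * D * (r * t * f) ≡ f * (r * D) * (t * S)
  regroup″ = solve-∀

perfect-bound : .{{NonZero n}} → Odd n → σ n ≡ 2 * n → IsSmallestPrimeFactor p n →
  numerator n * (4 * (p * p)) ℕ.≤ (8 * (p * p) ℕ.+ 9) * denominator n
perfect-bound {n} {p} odd perfect spf with squarefull? n
... | inj₁ sqf = squarefull-case {p = p} perfect (smallest-bound odd spf ∣-refl sqf)
... | inj₂ (q , M , pq , refl , q∤M) = exceptional-case pq q∤M (3≤smallest odd spf)
  (exceptional-prime-large odd spf pq q∤M refl perfect) perfect
  (smallest-bound odd spf (n∣m*n q) (squarefull-perfect-cofactor odd pq q∤M perfect))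
  where
  instance
    M≢0 : NonZero M
    M≢0 = m*n≢0⇒n≢0 q

-- Transfer to rational numbers

-- `_/_` reduces to lowest terms, so here and in the next two lemmas the computation is made on
-- unnormalised fractions and carried back along `toℚᵘ`.
/-*-/ : ∀ a b c d .{{_ : NonZero b}} .{{_ : NonZero d}} →
  + a / b ℚ.* (+ c / d) ≡ _/_ (+ (a * c)) (b * d) {{m*n≢0 b d}}
/-*-/ a b@(suc b′) c d@(suc d′) = ℚ.toℚᵘ-injective (begin
  toℚᵘ (+ a / b ℚ.* (+ c / d))               ≈⟨ ℚ.toℚᵘ-homo-* (+ a / b) (+ c / d) ⟩
  toℚᵘ (+ a / b) ℚᵘ.* toℚᵘ (+ c / d)         ≈⟨ ℚᵘ.*-cong (ℚ.toℚᵘ-fromℚᵘ (mkℚᵘ (+ a) b′)) (ℚ.toℚᵘ-fromℚᵘ (mkℚᵘ (+ c) d′)) ⟩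
  mkℚᵘ (+ a) b′ ℚᵘ.* mkℚᵘ (+ c) d′           ≡⟨ cong (λ i → mkℚᵘ i _) (ℤ.pos-* a c) ⟨
  mkℚᵘ (+ (a * c)) (pred (b * d))            ≈⟨ ℚ.toℚᵘ-fromℚᵘ (mkℚᵘ (+ (a * c)) (pred (b * d))) ⟨
  toℚᵘ (+ (a * c) / (b * d))                 ∎)
  where open ℚᵘ.≃-Reasoning

/-+-/ : ∀ a b c d .{{_ : NonZero b}} .{{_ : NonZero d}} →
  + a / b ℚ.+ + c / d ≡ _/_ (+ (a * d ℕ.+ c * b)) (b * d) {{m*n≢0 b d}}
/-+-/ a b@(suc b′) c d@(suc d′) = ℚ.toℚᵘ-injective (begin
  toℚᵘ (+ a / b ℚ.+ + c / d)                 ≈⟨ ℚ.toℚᵘ-homo-+ (+ a / b) (+ c / d) ⟩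
  toℚᵘ (+ a / b) ℚᵘ.+ toℚᵘ (+ c / d)         ≈⟨ ℚᵘ.+-cong (ℚ.toℚᵘ-fromℚᵘ (mkℚᵘ (+ a) b′)) (ℚ.toℚᵘ-fromℚᵘ (mkℚᵘ (+ c) d′)) ⟩
  mkℚᵘ (+ a) b′ ℚᵘ.+ mkℚᵘ (+ c) d′           ≡⟨ cong (λ i → mkℚᵘ i _) (cong₂ ℤ._+_ (ℤ.pos-* a d) (ℤ.pos-* c b)) ⟨
  mkℚᵘ (+ (a * d ℕ.+ c * b)) (pred (b * d))  ≈⟨ ℚ.toℚᵘ-fromℚᵘ (mkℚᵘ (+ (a * d ℕ.+ c * b)) (pred (b * d))) ⟨
  toℚᵘ (+ (a * d ℕ.+ c * b) / (b * d))       ∎)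
  where open ℚᵘ.≃-Reasoning

/-mono-≤ : ∀ a b c d .{{_ : NonZero b}} .{{_ : NonZero d}} →
  a * d ℕ.≤ c * b → + a / b ≤ + c / d
/-mono-≤ a b@(suc b′) c d@(suc d′) ad≤cb = ℚ.toℚᵘ-cancel-≤ (begin
  toℚᵘ (+ a / b)  ≃⟨ ℚ.toℚᵘ-fromℚᵘ (mkℚᵘ (+ a) b′) ⟩
  mkℚᵘ (+ a) b′   ≤⟨ *≤* (subst₂ ℤ._≤_ (ℤ.pos-* a d) (ℤ.pos-* c b) (ℤ.+≤+ ad≤cb)) ⟩
  mkℚᵘ (+ c) d′   ≃⟨ ℚ.toℚᵘ-fromℚᵘ (mkℚᵘ (+ c) d′) ⟨
  toℚᵘ (+ c / d)  ∎)
  where open ℚᵘ.≤-Reasoning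

product-pred≢0 : All Prime xs → NonZero (product (map pred xs))
product-pred≢0 []                          = _
product-pred≢0 {zero ∷ _}        (pp ∷ _)  = contradiction pp ¬prime[0]
product-pred≢0 {suc zero ∷ _}    (pp ∷ _)  = contradiction pp ¬prime[1]
product-pred≢0 {ℕ.2+ k ∷ xs}     (_ ∷ pps) = m*n≢0 (suc k) (product (map pred xs)) {{_}} {{product-pred≢0 pps}}

-- Primality excludes the dummy branch of `p/[p-1]`, so every factor is p / (p - 1) and the
-- fractions multiply out.
∏p/[p-1] : (pps : All Prime xs) →
  foldr ℚ._*_ 1ℚ (map p/[p-1] xs) ≡ _/_ (+ product xs) (product (map pred xs)) {{product-pred≢0 pps}}
∏p/[p-1] []                         = refl
∏p/[p-1] {zero ∷ _}       (pp ∷ _)  = contradiction pp ¬prime[0]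
∏p/[p-1] {suc zero ∷ _}   (pp ∷ _)  = contradiction pp ¬prime[1]
∏p/[p-1] {ℕ.2+ k ∷ xs}    (_ ∷ pps) = trans (cong (p/[p-1] (ℕ.2+ k) ℚ.*_) (∏p/[p-1] pps))
  (/-*-/ (ℕ.2+ k) (suc k) (product xs) (product (map pred xs)) {{_}} {{product-pred≢0 pps}})

proposition6 : (n p₁ : ℕ) → Odd n → Perfect n → (spf : IsSmallestPrimeFactor p₁ n) →
    H n ≤ + 2 / 1 + _/_ (+ 9) (4 * p₁ ^ 2) {{4p²≢0 spf}}
proposition6 n p odd (n>0 , perfect) spf =
  -- Each side is rewritten as a single fraction, so that cross-multiplying leads to
  -- `perfect-bound`.
  subst₂ _≤_ (sym (∏p/[p-1] pps)) (sym (/-+-/ 2 1 9 (4 * p ^ 2)))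
    (/-mono-≤ (numerator n) (denominator n) (2 * (4 * p ^ 2) ℕ.+ 9 * 1) (1 * (4 * p ^ 2)) (begin
      numerator n * (1 * (4 * p ^ 2))                       ≡⟨ cong (numerator n *_) (4p²≡ p) ⟩
      numerator n * (4 * (p * p))                           ≤⟨ perfect-bound odd perfect spf ⟩
      (8 * (p * p) ℕ.+ 9) * denominator n                   ≡⟨ cong (_* denominator n) (8p²+9≡ p) ⟩
      (2 * (4 * p ^ 2) ℕ.+ 9 * 1) * denominator n           ∎))
  where
  open ≤-Reasoning

  pps : All Prime (primeDivisors n)
  pps = All.tabulate (proj₁ ∘ ∈-primeDivisors⁻ n)

  instance
    _ = >-nonZero n>0
    _ = 4p²≢0 spf
    _ = m*n≢0 1 (4 * p ^ 2)
    _ = product-pred≢0 pps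

  -- `p ^ 2` appears in its unfolded form p * (p * 1).
  4p²≡ : ∀ p → 1 * (4 * (p * (p * 1))) ≡ 4 * (p * p)
  4p²≡ = solve-∀
  8p²+9≡ : ∀ p → 8 * (p * p) ℕ.+ 9 ≡ 2 * (4 * (p * (p * 1))) ℕ.+ 9 * 1
  8p²+9≡ = solve-∀
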